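{- The relative simplicial complex $X=(Q^*,A^*)$ is not partitionable.
   Context: $Q^*$ is the $3$-dimensional simplicial complex on vertex set $\{0,1,\dots,13\}$ whose faces are all subsets of the following $20$ facets: $\{2,5,6,12\}$, $\{1,5,8,11\}$, $\{0,1,2,5\}$, $\{1,4,8,9\}$, $\{1,2,3,10\}$, $\{4,5,8,13\}$, $\{0,1,2,3\}$, $\{1,4,9,10\}$, $\{1,2,9,10\}$, $\{1,2,5,6\}$, $\{0,2,5,12\}$, $\{4,5,7,13\}$, $\{1,4,5,8\}$, $\{1,2,6,9\}$, $\{1,3,4,7\}$, $\{1,3,4,10\}$, $\{1,5,6,11\}$, $\{1,4,5,7\}$, $\{1,6,9,11\}$, $\{1,8,9,11\}$. $A^*$ is the induced subcomplex of $Q^*$ on vertex set $\{0,2,3,4,6,7,8,10,12,13\}$; its facets are $\{0,2,3\}$, $\{4,7,13\}$, $\{3,4,10\}$, $\{0,2,12\}$, $\{3,4,7\}$, $\{2,3,10\}$, $\{2,6,12\}$, $\{4,8,13\}$. A relative simplicial complex $(\Delta,\Gamma)$ is a pair of simplicial complexes with $\Gamma\subseteq\Delta$; its faces are the elements of $\Delta\setminus\Gamma$, and its facets are the inclusion-maximal faces of $\Delta\setminus\Gamma$. A pure relative complex with facets $F_1,\dots,F_n$ is partitionable if its set of faces is a disjoint union of Boolean intervals $[R_i,F_i]=\{G : R_i\subseteq G\subseteq F_i\}$, $i=1,\dots,n$ (each interval consisting of faces of the relative complex). -}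

module Defs where

open import Agda.Builtin.FromNat using (Number; fromNat)
open import Data.Fin.Base using (Fin)
import Data.Fin.Literals as FinLiterals
open import Data.Fin.Subset using (Subset; _⊆_; ∣_∣; ⁅_⁆; _∪_)
open import Data.Fin.Subset.Properties using (⊆-refl; ⊆-trans)
open import Data.List.Base using (List; []; _∷_)
open import Data.List.Membership.Propositional using (find; lose)
open import Data.List.Relation.Unary.All as All using (All)
open import Data.List.Relation.Unary.Any as Any using (Any)
open import Data.Nat.Base using (ℕ)
import Data.Nat.Literals as NatLiterals
import Data.Nat.Properties as ℕ
open import Data.Product.Base using (∃; _×_; _,_; proj₁)
open import Data.Unit.Base using (tt) -- instance for numeric literals
open import Function.Definitions using (Injective)
open import Level using (0ℓ)
open import Relation.Binary.PropositionalEquality using (_≡_; sym; trans; cong)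
open import Relation.Nullary using (¬_)
open import Relation.Nullary.Decidable using (from-yes)
open import Relation.Unary using (Pred)

private
  variable
    n : ℕ

-- Elements of the ground set Fin n need not themselves be vertices, and the
-- complex may be void (no faces at all, not even ∅).
record SimplicialComplex (n : ℕ) : Set₁ where
  field
    IsFace      : Pred (Subset n) 0ℓ
    down-closed : ∀ {σ τ} → IsFace σ → τ ⊆ σ → IsFace τ

open SimplicialComplex

generatedBy : List (Subset n) → SimplicialComplex n
generatedBy Fs .IsFace σ             = Any (σ ⊆_) Fs
generatedBy Fs .down-closed {σ} {τ} σ∈Δ τ⊆σ =
  Any.map {P = σ ⊆_} {Q = τ ⊆_} (λ σ⊆F → ⊆-trans τ⊆σ σ⊆F) σ∈Δ

induced : SimplicialComplex n → Subset n → SimplicialComplex n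
induced Δ W .IsFace σ                     = IsFace Δ σ × σ ⊆ W
induced Δ W .down-closed (σ∈Δ , σ⊆W) τ⊆σ =
  down-closed Δ σ∈Δ τ⊆σ , ⊆-trans τ⊆σ σ⊆W

record RelativeComplex (n : ℕ) : Set₁ where
  field
    Δ Γ : SimplicialComplex n
    Γ⊆Δ : ∀ {σ} → IsFace Γ σ → IsFace Δ σ

  RelFace : Pred (Subset n) 0ℓ
  RelFace σ = IsFace Δ σ × ¬ IsFace Γ σ

  RelFacet : Pred (Subset n) 0ℓ
  RelFacet σ = RelFace σ × (∀ {τ} → RelFace τ → σ ⊆ τ → σ ≡ τ)

  Pure : Set
  Pure = ∀ {σ τ} → RelFacet σ → RelFacet τ → ∣ σ ∣ ≡ ∣ τ ∣

record PureRelativeComplex (n : ℕ) : Set₁ where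
  field
    relativeComplex : RelativeComplex n
  open RelativeComplex relativeComplex public
  field
    pure : Pure

infix 4 _∈[_,_]

_∈[_,_] : Subset n → Subset n → Subset n → Set
G ∈[ R , F ] = R ⊆ G × G ⊆ F

record Partitionable (X : PureRelativeComplex n) : Set where
  open PureRelativeComplex X
  field
    -- F lists the facets of X, each exactly once.
    m            : ℕ
    F            : Fin m → Subset n
    F-facet      : ∀ i → RelFacet (F i)
    F-injective  : Injective _≡_ _≡_ F
    F-exhaustive : ∀ {σ} → RelFacet σ → ∃ λ i → F i ≡ σ

    R        : Fin m → Subset n
    R⊆F      : ∀ i → R i ⊆ F i
    faces    : ∀ i {G} → G ∈[ R i , F i ] → RelFace G
    covering : ∀ {G} → RelFace G → ∃ λ i → G ∈[ R i , F i ]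
    disjoint : ∀ {i j G} → G ∈[ R i , F i ] → G ∈[ R j , F j ] → i ≡ j

private
  instance
    ℕ-literals : Number ℕ
    ℕ-literals = NatLiterals.number

    Fin-literals : Number (Fin n)
    Fin-literals {n} = FinLiterals.number n

tetrahedron : (a b c d : Fin 14) → Subset 14
tetrahedron a b c d = ⁅ a ⁆ ∪ ⁅ b ⁆ ∪ ⁅ c ⁆ ∪ ⁅ d ⁆

Q*-facets : List (Subset 14)
Q*-facets =
  tetrahedron 2 5 6 12 ∷
  tetrahedron 1 5 8 11 ∷
  tetrahedron 0 1 2 5 ∷
  tetrahedron 1 4 8 9 ∷
  tetrahedron 1 2 3 10 ∷
  tetrahedron 4 5 8 13 ∷
  tetrahedron 0 1 2 3 ∷
  tetrahedron 1 4 9 10 ∷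
  tetrahedron 1 2 9 10 ∷
  tetrahedron 1 2 5 6 ∷
  tetrahedron 0 2 5 12 ∷
  tetrahedron 4 5 7 13 ∷
  tetrahedron 1 4 5 8 ∷
  tetrahedron 1 2 6 9 ∷
  tetrahedron 1 3 4 7 ∷
  tetrahedron 1 3 4 10 ∷
  tetrahedron 1 5 6 11 ∷
  tetrahedron 1 4 5 7 ∷
  tetrahedron 1 6 9 11 ∷
  tetrahedron 1 8 9 11 ∷
  []

Q* : SimplicialComplex 14
Q* = generatedBy Q*-facets

A*-vertices : Subset 14
A*-vertices =
  ⁅ 0 ⁆ ∪ ⁅ 2 ⁆ ∪ ⁅ 3 ⁆ ∪ ⁅ 4 ⁆ ∪ ⁅ 6 ⁆ ∪ ⁅ 7 ⁆ ∪ ⁅ 8 ⁆ ∪ ⁅ 10 ⁆ ∪ ⁅ 12 ⁆ ∪ ⁅ 13 ⁆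

A* : SimplicialComplex 14
A* = induced Q* A*-vertices

⟨Q*,A*⟩ : RelativeComplex 14
⟨Q*,A*⟩ = record { Δ = Q* ; Γ = A* ; Γ⊆Δ = proj₁ }

Q*-facets-size : All (λ F → ∣ F ∣ ≡ 4) Q*-facets
Q*-facets-size = from-yes (All.all? (λ F → ∣ F ∣ ℕ.≟ 4) Q*-facets)

-- A facet of the pair lies in some F from the list; F is again a face of the
-- pair because A* is closed under passing to subsets, so the two coincide.
⟨Q*,A*⟩-facet-size : ∀ {σ} → RelativeComplex.RelFacet ⟨Q*,A*⟩ σ → ∣ σ ∣ ≡ 4
⟨Q*,A*⟩-facet-size {σ} ((σ∈Q , σ∉A) , maximal) with find σ∈Q
... | F , F∈Fs , σ⊆F =
  trans (cong ∣_∣ (maximal (F∈Q , F∉A) σ⊆F)) (All.lookup Q*-facets-size F∈Fs)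
  where
  F∈Q : IsFace Q* F
  F∈Q = lose F∈Fs ⊆-refl

  F∉A : ¬ IsFace A* F
  F∉A F∈A = σ∉A (down-closed A* F∈A σ⊆F)

X : PureRelativeComplex 14
X = record
  { relativeComplex = ⟨Q*,A*⟩
  ; pure            = λ σ-facet τ-facet →
      trans (⟨Q*,A*⟩-facet-size σ-facet) (sym (⟨Q*,A*⟩-facet-size τ-facet))
  }

{-# OPTIONS --safe #-}
-- The pair has the symmetry 2 ↔ 4, 6 ↔ 8, 12 ↔ 13, 0 ↔ 7 fixing 1, 5, 9, 11.
-- In a partition every face containing 1, 5, 9 or 11 lies in exactly one
-- interval, and an interval containing G and H contains G ∩ H.
-- Only 1269 contains 269, and 26 is a face of A*, so 126 must be in the
-- interval of 1256; hence 256 is in that of 2 5 6 12, which, having 5 6 12 as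
-- well, also owns 56.  Since only 1 5 6 11 contains 5 6 11, it cannot have 156,
-- which is therefore in the interval of 1256.  Now 125 belongs to 0125 or to
-- 1256, and so does the edge 15, as 0125 has 015 and 1256 has 156.
-- Symmetrically, 15 belongs to 1457 or to 1458, a contradiction.
module Submission where

open import Defs
open import Agda.Builtin.FromNat using (Number; fromNat)
open import Data.Fin.Base using (Fin)
import Data.Fin.Literals as FinLiterals
open import Data.Fin.Subset using (Subset; _∈_; _∉_; _⊆_; _∪_; _∩_; ⁅_⁆)
open import Data.Fin.Subset.Properties
  using (_∈?_; _⊆?_; ⊆-refl; ⊆-trans; p⊆p∪q; p∩q⊆p; x∈⁅x⁆; x∈p∩q⁺)
open import Data.List.Base using (List; []; _∷_; filter)
open import Data.List.Membership.Propositional using (find; lose) renaming (_∈_ to _∈ˡ_)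
open import Data.List.Membership.Propositional.Properties using (∈-filter⁺; ∈-filter⁻)
open import Data.List.Relation.Binary.Permutation.Propositional
  using (_↭_; ↭-refl; ↭-sym; swap)
open import Data.List.Relation.Binary.Permutation.Propositional.Properties
  using (Any-resp-↭; ∈-resp-↭)
open import Data.List.Relation.Unary.Any using (Any; here; there)
open import Data.Nat.Base using (ℕ)
import Data.Nat.Literals as NatLiterals
open import Data.Product.Base using (∃; _×_; _,_)
open import Data.Unit.Base using (tt) -- instance for numeric literals
open import Function.Base using (case_of_)
open import Relation.Binary.PropositionalEquality using (_≡_; _≢_; refl; sym; trans; subst)
open import Relation.Nullary using (¬_; contradiction)
open import Relation.Nullary.Decidable using (from-yes; from-no)

private
  instance
    ℕ-literals : Number ℕ
    ℕ-literals = NatLiterals.number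

    Fin-literals : ∀ {n} → Number (Fin n)
    Fin-literals {n} = FinLiterals.number n

cofacets : Subset 14 → List (Subset 14)
cofacets G = filter (G ⊆?_) Q*-facets

1∉A* : 1 ∉ A*-vertices
1∉A* = from-no (1 ∈? A*-vertices)

5∉A* : 5 ∉ A*-vertices
5∉A* = from-no (5 ∈? A*-vertices)

9∉A* : 9 ∉ A*-vertices
9∉A* = from-no (9 ∈? A*-vertices)

-- The finite data for one half of the argument, with `u v w z` standing for 2 6 12 0 or 4 8 13 7,
-- so that both sides of the symmetry share one proof. The lists are compared up to `↭` because the
-- two sides occur in different orders in `Q*-facets`. Each triple starts with a vertex outside
-- `A*-vertices`, as `cover` expects.
record Wedge (u v w z : Fin 14) : Set where
  constructor wedge
  field
    cofacets-9uv  : cofacets (⁅ 9 ⁆ ∪ ⁅ u ⁆ ∪ ⁅ v ⁆) ↭ tetrahedron 1 u v 9 ∷ []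
    cofacets-5vw  : cofacets (⁅ 5 ⁆ ∪ ⁅ v ⁆ ∪ ⁅ w ⁆) ↭ tetrahedron u 5 v w ∷ []
    cofacets-5v11 : cofacets (⁅ 5 ⁆ ∪ ⁅ v ⁆ ∪ ⁅ 11 ⁆) ↭ tetrahedron 1 5 v 11 ∷ []
    cofacets-15z  : cofacets (⁅ 1 ⁆ ∪ ⁅ 5 ⁆ ∪ ⁅ z ⁆) ↭ tetrahedron z 1 u 5 ∷ []
    cofacets-1uv  : cofacets (⁅ 1 ⁆ ∪ ⁅ u ⁆ ∪ ⁅ v ⁆)
                  ↭ tetrahedron 1 u 5 v ∷ tetrahedron 1 u v 9 ∷ []
    cofacets-5uv  : cofacets (⁅ 5 ⁆ ∪ ⁅ u ⁆ ∪ ⁅ v ⁆)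
                  ↭ tetrahedron 1 u 5 v ∷ tetrahedron u 5 v w ∷ []
    cofacets-15v  : cofacets (⁅ 1 ⁆ ∪ ⁅ 5 ⁆ ∪ ⁅ v ⁆)
                  ↭ tetrahedron 1 u 5 v ∷ tetrahedron 1 5 v 11 ∷ []
    cofacets-15u  : cofacets (⁅ 1 ⁆ ∪ ⁅ 5 ⁆ ∪ ⁅ u ⁆)
                  ↭ tetrahedron z 1 u 5 ∷ tetrahedron 1 u 5 v ∷ []
    1uv∩9uv  : (⁅ 1 ⁆ ∪ ⁅ u ⁆ ∪ ⁅ v ⁆) ∩ (⁅ 9 ⁆ ∪ ⁅ u ⁆ ∪ ⁅ v ⁆) ≡ ⁅ u ⁆ ∪ ⁅ v ⁆
    1uv∩5uv  : (⁅ 1 ⁆ ∪ ⁅ u ⁆ ∪ ⁅ v ⁆) ∩ (⁅ 5 ⁆ ∪ ⁅ u ⁆ ∪ ⁅ v ⁆) ≡ ⁅ u ⁆ ∪ ⁅ v ⁆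
    5uv∩5vw  : (⁅ 5 ⁆ ∪ ⁅ u ⁆ ∪ ⁅ v ⁆) ∩ (⁅ 5 ⁆ ∪ ⁅ v ⁆ ∪ ⁅ w ⁆) ≡ ⁅ 5 ⁆ ∪ ⁅ v ⁆
    15v∩5v11 : (⁅ 1 ⁆ ∪ ⁅ 5 ⁆ ∪ ⁅ v ⁆) ∩ (⁅ 5 ⁆ ∪ ⁅ v ⁆ ∪ ⁅ 11 ⁆) ≡ ⁅ 5 ⁆ ∪ ⁅ v ⁆
    15u∩15z  : (⁅ 1 ⁆ ∪ ⁅ 5 ⁆ ∪ ⁅ u ⁆) ∩ (⁅ 1 ⁆ ∪ ⁅ 5 ⁆ ∪ ⁅ z ⁆) ≡ ⁅ 1 ⁆ ∪ ⁅ 5 ⁆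
    15u∩15v  : (⁅ 1 ⁆ ∪ ⁅ 5 ⁆ ∪ ⁅ u ⁆) ∩ (⁅ 1 ⁆ ∪ ⁅ 5 ⁆ ∪ ⁅ v ⁆) ≡ ⁅ 1 ⁆ ∪ ⁅ 5 ⁆
    uv⊆A*    : ⁅ u ⁆ ∪ ⁅ v ⁆ ⊆ A*-vertices
    distinct : tetrahedron u 5 v w ≢ tetrahedron 1 5 v 11

wedge₂ : Wedge 2 6 12 0
wedge₂ = wedge
  ↭-refl ↭-refl ↭-refl ↭-refl
  ↭-refl (swap _ _ ↭-refl) ↭-refl ↭-refl
  refl refl refl refl refl refl (λ {x} → from-yes (⁅ 2 ⁆ ∪ ⁅ 6 ⁆ ⊆? A*-vertices) {x}) λ ()

wedge₄ : Wedge 4 8 13 7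
wedge₄ = wedge
  ↭-refl ↭-refl ↭-refl ↭-refl
  (swap _ _ ↭-refl) (swap _ _ ↭-refl) (swap _ _ ↭-refl) (swap _ _ ↭-refl)
  refl refl refl refl refl refl (λ {x} → from-yes (⁅ 4 ⁆ ∪ ⁅ 8 ⁆ ⊆? A*-vertices) {x}) λ ()

module _ (P : Partitionable X) where
  open PureRelativeComplex X using (RelFace; RelFacet)
  open Partitionable P

  infix 4 _▷_

  -- Intervals are named by their tops, so that explicit tetrahedra can be used whatever their
  -- indices in the partition.
  _▷_ : Subset 14 → Subset 14 → Set
  E ▷ G = ∃ λ i → F i ≡ E × G ∈[ R i , F i ]

  ▷-face : ∀ {E G} → E ▷ G → RelFace G
  ▷-face (i , _ , G∈I) = faces i G∈I

  ▷-unique : ∀ {E E′ G} → E ▷ G → E′ ▷ G → E ≡ E′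
  ▷-unique (i , refl , G∈I) (j , refl , G∈J) with refl ← disjoint G∈I G∈J = refl

  ▷-meet : ∀ {E G H K} → E ▷ G → E ▷ H → G ∩ H ≡ K → E ▷ K
  ▷-meet {G = G} {H} (i , Fi≡E , R⊆G , G⊆F) (j , Fj≡E , R⊆H , _) refl
    -- Equal tops mean one and the same interval, so its bottom lies in both `G` and `H`.
    with refl ← F-injective (trans Fi≡E (sym Fj≡E)) =
    i , Fi≡E , (λ x∈R → x∈p∩q⁺ (R⊆G x∈R , R⊆H x∈R)) , ⊆-trans (p∩q⊆p G H) G⊆F

  -- A listed tetrahedron around `E` is not in `A*`, since `E` is not; maximality then identifies
  -- the two.
  facet∈Q* : ∀ {E} → RelFacet E → E ∈ˡ Q*-facets
  facet∈Q* ((E∈Q , E∉A) , maximal) with E′ , E′∈Q* , E⊆E′ ← find E∈Q =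
    subst (_∈ˡ Q*-facets) (sym E≡E′) E′∈Q*
    where
    E≡E′ = maximal
      (lose E′∈Q* ⊆-refl , λ (_ , E′⊆A) → E∉A (E∈Q , ⊆-trans E⊆E′ E′⊆A)) E⊆E′

  -- The cofacet `E` makes the set a face of `Q*`, and `x` keeps it out of `A*`, so some interval
  -- contains it; the top of that interval is again a cofacet.
  cover : ∀ {x S E Es} → x ∉ A*-vertices → cofacets (⁅ x ⁆ ∪ S) ↭ E ∷ Es →
          Any (_▷ (⁅ x ⁆ ∪ S)) (E ∷ Es)
  cover {x} {S} x∉A G↭
    with ∈-filter⁻ (_ ⊆?_) {xs = Q*-facets} (∈-resp-↭ (↭-sym G↭) (here refl))
  ... | E∈Q* , G⊆E with covering (lose E∈Q* G⊆E , λ (_ , G⊆A) → x∉A (G⊆A (p⊆p∪q S (x∈⁅x⁆ x))))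
  ... | i , G∈I@(_ , G⊆F) =
    Any-resp-↭ G↭ (lose (∈-filter⁺ (_ ⊆?_) (facet∈Q* (F-facet i)) G⊆F) (i , refl , G∈I))

  cover₁ : ∀ {x S E} → x ∉ A*-vertices → cofacets (⁅ x ⁆ ∪ S) ↭ E ∷ [] → E ▷ (⁅ x ⁆ ∪ S)
  cover₁ x∉A G↭ with here E▷G ← cover x∉A G↭ = E▷G

  wedge-covers-15 : ∀ {u v w z} → Wedge u v w z →
    Any (_▷ (⁅ 1 ⁆ ∪ ⁅ 5 ⁆)) (tetrahedron z 1 u 5 ∷ tetrahedron 1 u 5 v ∷ [])
  wedge-covers-15 {u} {v} {w} {z} W = 15-covered
    where
    open Wedge W

    uv-uncovered : ∀ {E} → ¬ E ▷ (⁅ u ⁆ ∪ ⁅ v ⁆)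
    uv-uncovered E▷uv with uv∈Q , uv∉A ← ▷-face E▷uv = uv∉A (uv∈Q , uv⊆A*)

    1u5v▷1uv : tetrahedron 1 u 5 v ▷ (⁅ 1 ⁆ ∪ ⁅ u ⁆ ∪ ⁅ v ⁆)
    1u5v▷1uv with cover 1∉A* cofacets-1uv
    ... | here 1u5v▷1uv         = 1u5v▷1uv
    ... | there (here 1uv9▷1uv) =
      contradiction (▷-meet 1uv9▷1uv (cover₁ 9∉A* cofacets-9uv) 1uv∩9uv) uv-uncovered

    u5vw▷5uv : tetrahedron u 5 v w ▷ (⁅ 5 ⁆ ∪ ⁅ u ⁆ ∪ ⁅ v ⁆)
    u5vw▷5uv with cover 5∉A* cofacets-5uv
    -- One interval with both triangles would also contain their common edge, which lies in `A*`.
    ... | here 1u5v▷5uv         = contradiction (▷-meet 1u5v▷1uv 1u5v▷5uv 1uv∩5uv) uv-uncovered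
    ... | there (here u5vw▷5uv) = u5vw▷5uv

    u5vw▷5v : tetrahedron u 5 v w ▷ (⁅ 5 ⁆ ∪ ⁅ v ⁆)
    u5vw▷5v = ▷-meet u5vw▷5uv (cover₁ 5∉A* cofacets-5vw) 5uv∩5vw

    1u5v▷15v : tetrahedron 1 u 5 v ▷ (⁅ 1 ⁆ ∪ ⁅ 5 ⁆ ∪ ⁅ v ⁆)
    1u5v▷15v with cover 1∉A* cofacets-15v
    ... | here 1u5v▷15v          = 1u5v▷15v
    -- Otherwise the edge on 5 and `v` would lie in two intervals.
    ... | there (here 15v11▷15v) = contradiction
      (▷-unique u5vw▷5v (▷-meet 15v11▷15v (cover₁ 5∉A* cofacets-5v11) 15v∩5v11)) distinct

    15-covered : Any (_▷ (⁅ 1 ⁆ ∪ ⁅ 5 ⁆)) (tetrahedron z 1 u 5 ∷ tetrahedron 1 u 5 v ∷ [])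
    15-covered with cover 1∉A* cofacets-15u
    ... | here z1u5▷15u         = here (▷-meet z1u5▷15u (cover₁ 1∉A* cofacets-15z) 15u∩15z)
    ... | there (here 1u5v▷15u) = there (here (▷-meet 1u5v▷15u 1u5v▷15v 15u∩15v))

theorem3p6 : ¬ Partitionable X
theorem3p6 P with wedge-covers-15 P wedge₂ | wedge-covers-15 P wedge₄
-- The two wedges offer disjoint pairs of tops for the edge on 1 and 5, so no combination is
-- consistent.
... | here a         | here b         = case ▷-unique P a b of λ ()
... | here a         | there (here b) = case ▷-unique P a b of λ ()
... | there (here a) | here b         = case ▷-unique P a b of λ ()
... | there (here a) | there (here b) = case ▷-unique P a b of λ ()
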